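{- For every integer $n\geqslant 5$, the graph $D_n$ is $d$-balanced, i.e. $\gamma_{bd}(D_n)=0$.
   Context: For a simple undirected finite graph $G$ and $v\in V(G)$, the closed neighborhood is $N_G[v]=\{u\in V(G): uv\in E(G)\}\cup\{v\}$. A function $f\colon V(G)\to\{ -1,0,1\}$ is a balanced domination function (BDF) on $G$ if $\sum_{u\in N_G[v]} f(u)=0$ for every $v\in V(G)$. Its weight is $\omega_f=\sum_{v\in V(G)} f(v)$. The balanced domination number $\gamma_{bd}(G)$ is the maximum of $\omega_f$ over all BDFs $f$ on $G$. The graph $G$ is called $d$-balanced if $\gamma_{bd}(G)=0$. For $n\geqslant 5$, the convex polytope graph $D_n$ is the simple undirected graph with vertex set $V(D_n)=\{u_i,v_i,w_i,q_i \mid 0\leqslant i\leqslant n-1\}$ ($4n$ distinct vertices) and edge set $E(D_n)=\{u_iu_{i+1},\ q_iq_{i+1},\ u_iv_i,\ v_iw_i,\ v_{i+1}w_i,\ w_iq_i \mid 0\leqslant i\leqslant n-1\}$, where indices are taken modulo $n$. -}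

module Defs where

open import Data.Bool.Base using (if_then_else_)
open import Data.Fin.Base using (Fin; toℕ)
import Data.Fin.Properties as Fin
open import Data.Fin.Patterns using (0F; 1F; 2F; 3F)
open import Data.Integer.Base using (ℤ; 0ℤ; 1ℤ; -1ℤ; _≤_)
open import Data.Integer.Properties using (+-0-commutativeMonoid)
open import Data.Nat.Base as ℕ using (ℕ; suc; _≥_; s≤s; z≤n)
open import Data.Nat.DivMod using (_mod_; _%_; m%n<n; m<n⇒m%n≡m; n%n≡0)
import Data.Nat.Properties as ℕ
open import Data.Product.Base using (∃-syntax; _×_; _,_)
open import Data.Sum.Base using (_⊎_; inj₁; inj₂)
open import Function.Bundles using (_↔_; mk↔ₛ′; Inverse)
open import Function.Construct.Composition using (_↔-∘_)
open import Function.Construct.Symmetry using (↔-sym)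
open import Function.Properties.Inverse using (Inverse⇒Injection)
open import Level using (0ℓ)
open import Relation.Binary.Construct.Closure.Symmetric
  using (SymClosure; fwd; bwd; symmetric)
open import Relation.Binary.Core using (Rel)
open import Relation.Binary.Definitions using (Symmetric; Decidable; DecidableEquality)
open import Relation.Binary.PropositionalEquality.Core
  using (_≡_; _≢_; refl; sym; trans; cong)
open import Relation.Nullary.Decidable
  using (yes; no; does; map′; via-injection; _⊎-dec_)
open import Relation.Nullary.Negation.Core using (¬_)
open import Relation.Unary using (Pred)
import Relation.Unary as Unary

open import Algebra.Properties.CommutativeMonoid.Sum +-0-commutativeMonoid
  using (sum-syntax)

record Graph : Set₁ where
  infix 4 _∼_ _∼?_ _≟_
  field
    V       : Set
    order   : ℕ
    enum    : V ↔ Fin order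
    _∼_     : Rel V 0ℓ
    _∼?_    : Decidable _∼_
    ∼-sym   : Symmetric _∼_
    ∼-irrefl : ∀ x → ¬ (x ∼ x)

  _≟_ : DecidableEquality V
  _≟_ = via-injection (Inverse⇒Injection enum) Fin._≟_

  N[_] : V → Pred V 0ℓ
  N[ x ] y = y ∼ x ⊎ y ≡ x

  N[_]? : ∀ x → Unary.Decidable N[ x ]
  N[ x ]? y = (y ∼? x) ⊎-dec (y ≟ x)

  -- Independent of the choice of enumeration, since ℤ is commutative.
  ∑ᵥ : (V → ℤ) → ℤ
  ∑ᵥ g = ∑[ k < order ] g (Inverse.from enum k)

  ∑ᵥ-over : {P : Pred V 0ℓ} → Unary.Decidable P → (V → ℤ) → ℤ
  ∑ᵥ-over P? g = ∑ᵥ λ x → if does (P? x) then g x else 0ℤ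

data Value : Set where
  neg zer pos : Value

toℤ : Value → ℤ
toℤ neg = -1ℤ
toℤ zer = 0ℤ
toℤ pos = 1ℤ

module _ (G : Graph) where
  open Graph G

  IsBDF : (V → Value) → Set
  IsBDF f = ∀ x → ∑ᵥ-over N[ x ]? (λ y → toℤ (f y)) ≡ 0ℤ

  weight : (V → Value) → ℤ
  weight f = ∑ᵥ λ x → toℤ (f x)

  IsBDFWeight : Pred ℤ 0ℓ
  IsBDFWeight k = ∃[ f ] (IsBDF f × weight f ≡ k)

IsMaximum : Pred ℤ 0ℓ → ℤ → Set
IsMaximum P m = P m × (∀ k → P k → k ≤ m)

-- The relation "γ_bd(G) = m".  Integers have at most one maximum, so m is
-- determined by G.
IsBalancedDominationNumber : Graph → ℤ → Set
IsBalancedDominationNumber G = IsMaximum (IsBDFWeight G)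

DBalanced : Graph → Set
DBalanced G = IsBalancedDominationNumber G 0ℤ

next : ∀ {n} → Fin n → Fin n
next {n} i = (suc (toℕ i) mod n) {{Fin.nonZeroIndex i}}

next≢ : ∀ {n} → n ≥ 2 → (i : Fin n) → next i ≢ i
next≢ {suc n} n≥2 i eq with suc (toℕ i) ℕ.<? suc n
... | yes i+1<n = ℕ.1+n≢n (trans (sym (m<n⇒m%n≡m i+1<n)) (toℕ-next eq))
  where
  toℕ-next : next i ≡ i → suc (toℕ i) % suc n ≡ toℕ i
  toℕ-next e = trans (sym (Fin.toℕ-fromℕ< _)) (cong toℕ e)
... | no i+1≮n = ℕ.<⇒≢ n≥2 (trans (cong suc (sym i≡0)) i+1≡n)
  where
  i+1≡n : suc (toℕ i) ≡ suc n
  i+1≡n = ℕ.≤-antisym (Fin.toℕ<n i) (ℕ.≮⇒≥ i+1≮n)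

  i≡0 : toℕ i ≡ 0
  i≡0 = trans (sym (trans (sym (Fin.toℕ-fromℕ< (m%n<n (suc (toℕ i)) (suc n)))) (cong toℕ eq)))
          (trans (cong (_% suc n) i+1≡n) (n%n≡0 (suc n)))

data Vertex (n : ℕ) : Set where
  u v w q : Fin n → Vertex n

data Edge {n : ℕ} : Rel (Vertex n) 0ℓ where
  uu  : ∀ i → Edge (u i) (u (next i))
  qq  : ∀ i → Edge (q i) (q (next i))
  uv  : ∀ i → Edge (u i) (v i)
  vw  : ∀ i → Edge (v i) (w i)
  v⁺w : ∀ i → Edge (v (next i)) (w i)
  wq  : ∀ i → Edge (w i) (q i)

Vertex↔ : ∀ {n} → Vertex n ↔ Fin (4 ℕ.* n)
Vertex↔ {n} = ↔-sym Fin.*↔× ↔-∘ mk↔ₛ′ to from to∘from from∘to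
  where
  to : Vertex n → Fin 4 × Fin n
  to (u i) = 0F , i
  to (v i) = 1F , i
  to (w i) = 2F , i
  to (q i) = 3F , i

  from : Fin 4 × Fin n → Vertex n
  from (0F , i) = u i
  from (1F , i) = v i
  from (2F , i) = w i
  from (3F , i) = q i

  to∘from : ∀ p → to (from p) ≡ p
  to∘from (0F , i) = refl
  to∘from (1F , i) = refl
  to∘from (2F , i) = refl
  to∘from (3F , i) = refl

  from∘to : ∀ x → from (to x) ≡ x
  from∘to (u i) = refl
  from∘to (v i) = refl
  from∘to (w i) = refl
  from∘to (q i) = refl

edge? : ∀ {n} → Decidable (Edge {n})
edge? (u i) (u j) = map′ (λ { refl → uu i }) (λ { (uu _) → refl }) (next i Fin.≟ j)
edge? (u i) (v j) = map′ (λ { refl → uv i }) (λ { (uv _) → refl }) (i Fin.≟ j)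
edge? (u i) (w j) = no λ ()
edge? (u i) (q j) = no λ ()
edge? (v i) (u j) = no λ ()
edge? (v i) (v j) = no λ ()
edge? (v i) (w j) =
  map′ (λ { (inj₁ refl) → vw i ; (inj₂ refl) → v⁺w j })
       (λ { (vw _) → inj₁ refl ; (v⁺w _) → inj₂ refl })
       ((i Fin.≟ j) ⊎-dec (next j Fin.≟ i))
edge? (v i) (q j) = no λ ()
edge? (w i) (u j) = no λ ()
edge? (w i) (v j) = no λ ()
edge? (w i) (w j) = no λ ()
edge? (w i) (q j) = map′ (λ { refl → wq i }) (λ { (wq _) → refl }) (i Fin.≟ j)
edge? (q i) (u j) = no λ ()
edge? (q i) (v j) = no λ ()
edge? (q i) (w j) = no λ ()
edge? (q i) (q j) = map′ (λ { refl → qq i }) (λ { (qq _) → refl }) (next i Fin.≟ j)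

edge⇒≢ : ∀ {n} → n ≥ 2 → {x y : Vertex n} → Edge x y → x ≢ y
edge⇒≢ n≥2 (uu i) eq = next≢ n≥2 i (sym (u-injective eq))
  where
  u-injective : ∀ {i j} → u i ≡ u j → i ≡ j
  u-injective refl = refl
edge⇒≢ n≥2 (qq i) eq = next≢ n≥2 i (sym (q-injective eq))
  where
  q-injective : ∀ {i j} → q i ≡ q j → i ≡ j
  q-injective refl = refl
edge⇒≢ n≥2 (uv i) ()
edge⇒≢ n≥2 (vw i) ()
edge⇒≢ n≥2 (v⁺w i) ()
edge⇒≢ n≥2 (wq i) ()

D : ∀ n → n ≥ 5 → Graph
D n n≥5 = record
  { V        = Vertex n
  ; order    = 4 ℕ.* n
  ; enum     = Vertex↔
  ; _∼_      = SymClosure Edge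
  ; _∼?_     = λ x y → map′ (λ { (inj₁ e) → fwd e ; (inj₂ e) → bwd e })
                            (λ { (fwd e) → inj₁ e ; (bwd e) → inj₂ e })
                            (edge? x y ⊎-dec edge? y x)
  ; ∼-sym    = symmetric Edge
  ; ∼-irrefl = λ { x (fwd e) → edge⇒≢ n≥2 e refl ; x (bwd e) → edge⇒≢ n≥2 e refl }
  }
  where
  n≥2 : n ≥ 2
  n≥2 = ℕ.≤-trans (s≤s (s≤s z≤n)) n≥5

{-# OPTIONS --safe #-}
-- D n is cubic, and a balanced domination function f on an r-regular graph has weight 0:
-- summing f over all closed neighbourhoods counts every vertex r + 1 times, so
-- 0 = (r + 1) · ω_f.
module Submission where

open import Defs
open import Data.Bool.Base using (if_then_else_)
open import Data.Bool.Properties using (if-eta)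
open import Data.Fin.Base using (Fin; toℕ; punchIn)
open import Data.Fin.Properties
  using (toℕ<n; toℕ-injective; toℕ-fromℕ<; punchInᵢ≢i; nonZeroIndex)
open import Data.Integer.Base using (ℤ; +_; 0ℤ; _+_; _*_)
open import Data.Integer.Properties
  using (+-0-commutativeMonoid; +-*-semiring; +-identityˡ; +-identityʳ; *-zeroˡ;
         *-identityˡ; *-distribʳ-+; i*j≡0⇒i≡0∨j≡0; ≤-reflexive)
open import Data.List.Base using (List; []; _∷_; length)
open import Data.List.Membership.Propositional using (_∈_)
import Data.List.Membership.DecPropositional as DecMembership
open import Data.List.Relation.Unary.All using ([]; _∷_)
open import Data.List.Relation.Unary.All.Properties using (All¬⇒¬Any)
open import Data.List.Relation.Unary.Any using (here; there)
open import Data.List.Relation.Unary.Unique.Propositional using (Unique; []; _∷_)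
open import Data.Nat.Base as ℕ using (ℕ; suc; pred; _≥_; NonZero)
open import Data.Nat.Divisibility using (_∣_; divides-refl; ∣⇒≤)
open import Data.Nat.DivMod
  using (_%_; _/_; _mod_; m<n⇒m%n≡m; [m+n]%n≡m%n; %-distribˡ-+; m%n%n≡m%n;
         m≡m%n+[m/n]*n)
import Data.Nat.Properties as ℕ
open import Data.Product.Base using (∃-syntax; _×_; _,_)
open import Data.Sum.Base using (inj₁; inj₂)
open import Function.Base using (_∘_)
open import Function.Bundles using (_⇔_; mk⇔; Inverse)
open import Relation.Binary.Construct.Closure.Symmetric using (fwd; bwd)
open import Relation.Binary.PropositionalEquality
open import Relation.Nullary.Decidable using (Dec; yes; no; does; does-⇔; dec-true; dec-false; _⊎-dec_)
open import Relation.Nullary.Negation using (¬_; contradiction)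

open import Algebra.Properties.CommutativeMonoid.Sum +-0-commutativeMonoid
  using (sum; sum-cong-≗; sum-remove; sum-replicate-zero; ∑-distrib-+; ∑-comm)
open import Algebra.Properties.Semiring.Sum +-*-semiring using (*-distribˡ-sum)

open ≡-Reasoning

-- The argument is double counting on a regular graph. Adding the equations that `f` satisfies at
-- all vertices gives 0. In this double sum the value `f y` occurs once for each `x` with `y` in
-- `N[ x ]`; since closed neighbourhoods are symmetric, these `x` form `N[ y ]`, which has `r + 1`
-- elements. Hence `r + 1` times the weight is 0, and so the weight is 0 because ℤ has no zero
-- divisors. The zero function is a BDF, so the maximum is attained (`regular⇒DBalanced`). What is
-- specific to `D n` is that it is cubic (`D-regular`): each closed neighbourhood is listed
-- explicitly, and its four entries are distinct because `i - 1`, `i`, `i + 1` are distinct modulo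
-- `n`.

sum-zero : ∀ {n} (t : Fin n → ℤ) → (∀ j → t j ≡ 0ℤ) → sum t ≡ 0ℤ
sum-zero {n} t t≡0 = trans (sum-cong-≗ t≡0) (sum-replicate-zero n)

sum-concentrated : ∀ {n} (t : Fin n → ℤ) i → (∀ j → j ≢ i → t j ≡ 0ℤ) → sum t ≡ t i
sum-concentrated {suc n} t i t≡0 = begin
  sum t                       ≡⟨ sum-remove {i = i} t ⟩
  t i + sum (t ∘ punchIn i)   ≡⟨ cong (λ a → t i + a) (sum-zero _ λ j → t≡0 _ (punchInᵢ≢i i j)) ⟩
  t i + 0ℤ                    ≡⟨ +-identityʳ (t i) ⟩
  t i                         ∎

-- Indicators add over a disjoint union. This peels the head off a list in `∑ᵥ-over-list`.
if-⊎ : ∀ {A B : Set} (a? : Dec A) (b? : Dec B) → (A → ¬ B) → ∀ c →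
       (if does (a? ⊎-dec b?) then c else 0ℤ)
       ≡ (if does a? then c else 0ℤ) + (if does b? then c else 0ℤ)
if-⊎ (yes a) (yes b) disjoint c = contradiction b (disjoint a)
if-⊎ (yes _) (no _)  disjoint c = sym (+-identityʳ c)
if-⊎ (no _)  (yes _) disjoint c = sym (+-identityˡ c)
if-⊎ (no _)  (no _)  disjoint c = refl

-- Double counting on regular graphs

module _ (G : Graph) where
  open Graph G
  open Inverse enum using (to; from; strictlyInverseˡ; strictlyInverseʳ)
  open DecMembership _≟_ using (_∈?_)

  ∑ᵥ-over-singleton : ∀ x c → ∑ᵥ-over (_≟ x) (λ _ → c) ≡ c
  ∑ᵥ-over-singleton x c = begin
    ∑ᵥ-over (_≟ x) (λ _ → c)
      ≡⟨ sum-concentrated _ (to x) (λ j j≢ → cong (if_then c else 0ℤ)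
           (dec-false (from j ≟ x) λ eq → j≢ (trans (sym (strictlyInverseˡ j)) (cong to eq)))) ⟩
    (if does (from (to x) ≟ x) then c else 0ℤ)
      ≡⟨ cong (if_then c else 0ℤ) (dec-true (from (to x) ≟ x) (strictlyInverseʳ x)) ⟩
    c ∎

  -- Induction on the list: `Unique` keeps the head out of the tail, so each entry contributes
  -- exactly one `c`.
  ∑ᵥ-over-list : ∀ {xs} → Unique xs → ∀ c →
                 ∑ᵥ-over (_∈? xs) (λ _ → c) ≡ + length xs * c
  ∑ᵥ-over-list []                   c = trans (sum-zero {order} _ λ _ → refl) (sym (*-zeroˡ c))
  ∑ᵥ-over-list {x ∷ xs} (x∉ ∷ uniq) c = begin
    ∑ᵥ-over (_∈? x ∷ xs) (λ _ → c)
      ≡⟨ sum-cong-≗ (λ k → if-⊎ (from k ≟ x) (from k ∈? xs) (λ { refl → All¬⇒¬Any x∉ }) c) ⟩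
    ∑ᵥ (λ y → (if does (y ≟ x) then c else 0ℤ) + (if does (y ∈? xs) then c else 0ℤ))
      ≡⟨ ∑-distrib-+ {order} _ _ ⟩
    ∑ᵥ-over (_≟ x) (λ _ → c) + ∑ᵥ-over (_∈? xs) (λ _ → c)
      ≡⟨ cong₂ _+_ (∑ᵥ-over-singleton x c) (∑ᵥ-over-list uniq c) ⟩
    c + + length xs * c
      ≡⟨ cong (_+ + length xs * c) (*-identityˡ c) ⟨
    + 1 * c + + length xs * c
      ≡⟨ *-distribʳ-+ c (+ 1) (+ length xs) ⟨
    + suc (length xs) * c ∎

  -- Regularity is witnessed by a repetition-free list of each closed neighbourhood, whence `suc r`
  -- and not `r`. Such a list is what the counting consumes, and it can be written out for `D n`.
  IsRegular : ℕ → Set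
  IsRegular r = ∀ x → ∃[ xs ] (Unique xs × length xs ≡ suc r × (∀ y → N[ x ] y ⇔ y ∈ xs))

  N-sym : ∀ {x y} → N[ x ] y → N[ y ] x
  N-sym (inj₁ y∼x) = inj₁ (∼-sym y∼x)
  N-sym (inj₂ y≡x) = inj₂ (sym y≡x)

  ∑ᵥ-over-N : ∀ {r} → IsRegular r → ∀ x c → ∑ᵥ-over N[ x ]? (λ _ → c) ≡ + suc r * c
  ∑ᵥ-over-N {r} reg x c with xs , uniq , len , N⇔ ← reg x = begin
    ∑ᵥ-over N[ x ]? (λ _ → c)
      ≡⟨ sum-cong-≗ (λ k → cong (if_then c else 0ℤ)
           (does-⇔ (N⇔ (from k)) (N[ x ]? (from k)) (from k ∈? xs))) ⟩
    ∑ᵥ-over (_∈? xs) (λ _ → c)   ≡⟨ ∑ᵥ-over-list uniq c ⟩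
    + length xs * c              ≡⟨ cong (λ l → + l * c) len ⟩
    + suc r * c                  ∎

  regular⇒weight≡0 : ∀ {r} → IsRegular r → ∀ f → IsBDF G f → weight G f ≡ 0ℤ
  regular⇒weight≡0 {r} reg f bdf with i*j≡0⇒i≡0∨j≡0 (+ suc r) (begin
    + suc r * weight G f
      ≡⟨ *-distribˡ-sum {order} (+ suc r) _ ⟩
    ∑ᵥ (λ y → + suc r * toℤ (f y))
      ≡⟨ sum-cong-≗ (λ k → ∑ᵥ-over-N reg (from k) (toℤ (f (from k)))) ⟨
    ∑ᵥ (λ y → ∑ᵥ-over N[ y ]? (λ _ → toℤ (f y)))
      ≡⟨ ∑-comm {order} {order} _ ⟩
    ∑ᵥ (λ x → ∑ᵥ (λ y → if does (N[ y ]? x) then toℤ (f y) else 0ℤ))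
      -- By symmetry, the indicator of `x` in `N[ y ]` becomes that of `y` in `N[ x ]`, so each
      -- inner sum is the left side of the BDF condition at `x`.
      ≡⟨ sum-cong-≗ (λ j → sum-cong-≗ λ k → cong (if_then toℤ (f (from k)) else 0ℤ)
           (does-⇔ (mk⇔ N-sym N-sym) (N[ from k ]? (from j)) (N[ from j ]? (from k)))) ⟩
    ∑ᵥ (λ x → ∑ᵥ-over N[ x ]? (λ y → toℤ (f y)))
      ≡⟨ sum-zero {order} _ (λ k → bdf (from k)) ⟩
    0ℤ ∎)
  -- The other alternative, `+ suc r ≡ 0ℤ`, is refuted by unification.
  ... | inj₂ weight≡0 = weight≡0

  regular⇒DBalanced : ∀ {r} → IsRegular r → DBalanced G
  regular⇒DBalanced reg =
    ( (λ _ → zer)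
    , (λ x → sum-zero {order} _ λ k → if-eta (does (N[ x ]? (from k))))
    , sum-zero {order} _ λ _ → refl
    ) , λ k (f , bdf , weight≡k) →
          ≤-reflexive (trans (sym weight≡k) (regular⇒weight≡0 reg f bdf))

-- Arithmetic of indices modulo n

[m%n+o]%n≡[m+o]%n : ∀ m o n .{{_ : NonZero n}} → (m % n ℕ.+ o) % n ≡ (m ℕ.+ o) % n
[m%n+o]%n≡[m+o]%n m o n = begin
  (m % n ℕ.+ o) % n           ≡⟨ %-distribˡ-+ (m % n) o n ⟩
  (m % n % n ℕ.+ o % n) % n   ≡⟨ cong (λ a → (a ℕ.+ o % n) % n) (m%n%n≡m%n m n) ⟩
  (m % n ℕ.+ o % n) % n       ≡⟨ %-distribˡ-+ m o n ⟨
  (m ℕ.+ o) % n               ∎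

infixl 6 _⊕_
-- The shift `k` stands on the left of the sum so that `i ⊕ 1` computes to `next i`; the lemmas
-- below then apply to `next` directly.
_⊕_ : ∀ {n} → Fin n → ℕ → Fin n
_⊕_ {n} i k = ((k ℕ.+ toℕ i) mod n) {{nonZeroIndex i}}

toℕ-⊕ : ∀ {n} .{{_ : NonZero n}} (i : Fin n) k → toℕ (i ⊕ k) ≡ (k ℕ.+ toℕ i) % n
toℕ-⊕ i k = toℕ-fromℕ< _

⊕-⊕ : ∀ {n} (i : Fin n) k l → i ⊕ k ⊕ l ≡ i ⊕ (k ℕ.+ l)
⊕-⊕ {n@(suc _)} i k l = toℕ-injective (begin
  toℕ (i ⊕ k ⊕ l)                  ≡⟨ toℕ-⊕ (i ⊕ k) l ⟩
  (l ℕ.+ toℕ (i ⊕ k)) % n          ≡⟨ cong (λ a → (l ℕ.+ a) % n) (toℕ-⊕ i k) ⟩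
  (l ℕ.+ (k ℕ.+ toℕ i) % n) % n    ≡⟨ cong (_% n) (ℕ.+-comm l _) ⟩
  ((k ℕ.+ toℕ i) % n ℕ.+ l) % n    ≡⟨ [m%n+o]%n≡[m+o]%n (k ℕ.+ toℕ i) l n ⟩
  (k ℕ.+ toℕ i ℕ.+ l) % n          ≡⟨ cong (_% n) (ℕ.+-comm _ l) ⟩
  (l ℕ.+ (k ℕ.+ toℕ i)) % n        ≡⟨ cong (_% n) (ℕ.+-assoc l k (toℕ i)) ⟨
  (l ℕ.+ k ℕ.+ toℕ i) % n          ≡⟨ cong (λ a → (a ℕ.+ toℕ i) % n) (ℕ.+-comm l k) ⟩
  (k ℕ.+ l ℕ.+ toℕ i) % n          ≡⟨ toℕ-⊕ i (k ℕ.+ l) ⟨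
  toℕ (i ⊕ (k ℕ.+ l))              ∎)

⊕-n : ∀ {n} (i : Fin n) → i ⊕ n ≡ i
⊕-n {n@(suc _)} i = toℕ-injective (begin
  toℕ (i ⊕ n)          ≡⟨ toℕ-⊕ i n ⟩
  (n ℕ.+ toℕ i) % n    ≡⟨ cong (_% n) (ℕ.+-comm n (toℕ i)) ⟩
  (toℕ i ℕ.+ n) % n    ≡⟨ [m+n]%n≡m%n (toℕ i) n ⟩
  toℕ i % n            ≡⟨ m<n⇒m%n≡m (toℕ<n i) ⟩
  toℕ i                ∎)

-- Divide `k + toℕ i` by `n`: the remainder is `toℕ i` by hypothesis, and cancelling it leaves `k`
-- as a multiple of `n`.
⊕-fixed⇒∣ : ∀ {n} (i : Fin n) k → i ⊕ k ≡ i → n ∣ k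
⊕-fixed⇒∣ {n@(suc _)} i k eq = subst (n ∣_) (sym k≡) (divides-refl ((k ℕ.+ toℕ i) / n))
  where
  k≡ : k ≡ (k ℕ.+ toℕ i) / n ℕ.* n
  k≡ = ℕ.+-cancelˡ-≡ (toℕ i) k ((k ℕ.+ toℕ i) / n ℕ.* n) (begin
    toℕ i ℕ.+ k
      ≡⟨ ℕ.+-comm (toℕ i) k ⟩
    k ℕ.+ toℕ i
      ≡⟨ m≡m%n+[m/n]*n (k ℕ.+ toℕ i) n ⟩
    (k ℕ.+ toℕ i) % n ℕ.+ (k ℕ.+ toℕ i) / n ℕ.* n
      ≡⟨ cong (ℕ._+ (k ℕ.+ toℕ i) / n ℕ.* n) (trans (sym (toℕ-⊕ i k)) (cong toℕ eq)) ⟩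
    toℕ i ℕ.+ (k ℕ.+ toℕ i) / n ℕ.* n ∎)

-- Subtracting 1 is adding `n - 1` modulo `n`.
prev : ∀ {n} → Fin n → Fin n
prev {n} i = i ⊕ pred n

next-prev : ∀ {n} (i : Fin n) → next (prev i) ≡ i
next-prev {n@(suc m)} i = begin
  i ⊕ m ⊕ 1       ≡⟨ ⊕-⊕ i m 1 ⟩
  i ⊕ (m ℕ.+ 1)   ≡⟨ cong (i ⊕_) (ℕ.+-comm m 1) ⟩
  i ⊕ n           ≡⟨ ⊕-n i ⟩
  i               ∎

prev-next : ∀ {n} (i : Fin n) → prev (next i) ≡ i
prev-next {suc m} i = trans (⊕-⊕ i 1 m) (⊕-n i)

-- A common left inverse of the four constructors: `cong index` gives the injectivity of each.
index : ∀ {n} → Vertex n → Fin n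
index (u i) = i
index (v i) = i
index (w i) = i
index (q i) = i

-- Closed neighbourhoods in D n

module _ {n : ℕ} (n≥5 : n ≥ 5) where
  open Graph (D n n≥5) using (N[_])

  n≥3 : n ≥ 3
  n≥3 = ℕ.≤-trans (ℕ.m≤m+n 3 2) n≥5

  next≢id : ∀ (i : Fin n) → next i ≢ i
  next≢id = next≢ (ℕ.≤-trans (ℕ.m≤m+n 2 3) n≥5)

  prev≢id : ∀ (i : Fin n) → prev i ≢ i
  prev≢id i eq = next≢id i (trans (cong next (sym eq)) (next-prev i))

  -- Equality would give `i ⊕ 2 ≡ i`, hence `n` would divide 2, against `n ≥ 3`.
  prev≢next : ∀ (i : Fin n) → prev i ≢ next i
  prev≢next i eq = ℕ.<⇒≱ n≥3 (∣⇒≤ (⊕-fixed⇒∣ i 2 (begin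
    i ⊕ 2           ≡⟨ ⊕-⊕ i 1 1 ⟨
    next (next i)   ≡⟨ cong next eq ⟨
    next (prev i)   ≡⟨ next-prev i ⟩
    i               ∎)))

  closedNeighbours : Vertex n → List (Vertex n)
  closedNeighbours (u i) = u (prev i) ∷ u i ∷ u (next i) ∷ v i ∷ []
  closedNeighbours (v i) = v i ∷ u i ∷ w i ∷ w (prev i) ∷ []
  closedNeighbours (w i) = w i ∷ q i ∷ v i ∷ v (next i) ∷ []
  closedNeighbours (q i) = q (prev i) ∷ q i ∷ q (next i) ∷ w i ∷ []

  closedNeighbours-length : ∀ x → length (closedNeighbours x) ≡ 4
  closedNeighbours-length (u _) = refl
  closedNeighbours-length (v _) = refl
  closedNeighbours-length (w _) = refl
  closedNeighbours-length (q _) = refl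

  -- Vertices of different kinds differ by constructor; those of the same kind differ by index.
  closedNeighbours-unique : ∀ x → Unique (closedNeighbours x)
  closedNeighbours-unique (u i) =
      (prev≢id i ∘ cong index ∷ prev≢next i ∘ cong index ∷ (λ ()) ∷ [])
    ∷ (next≢id i ∘ sym ∘ cong index ∷ (λ ()) ∷ []) ∷ ((λ ()) ∷ []) ∷ [] ∷ []
  closedNeighbours-unique (v i) =
      ((λ ()) ∷ (λ ()) ∷ (λ ()) ∷ []) ∷ ((λ ()) ∷ (λ ()) ∷ [])
    ∷ (prev≢id i ∘ sym ∘ cong index ∷ []) ∷ [] ∷ []
  closedNeighbours-unique (w i) =
      ((λ ()) ∷ (λ ()) ∷ (λ ()) ∷ []) ∷ ((λ ()) ∷ (λ ()) ∷ [])
    ∷ (next≢id i ∘ sym ∘ cong index ∷ []) ∷ [] ∷ []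
  closedNeighbours-unique (q i) =
      (prev≢id i ∘ cong index ∷ prev≢next i ∘ cong index ∷ (λ ()) ∷ [])
    ∷ (next≢id i ∘ sym ∘ cong index ∷ (λ ()) ∷ []) ∷ ((λ ()) ∷ []) ∷ [] ∷ []

  N⇒closedNeighbours : ∀ x {y} → N[ x ] y → y ∈ closedNeighbours x
  N⇒closedNeighbours (u i) (inj₂ refl)           = there (here refl)
  -- Matching on the edge forces the centre to be `u (next j)`, so its listed predecessor is
  -- `u (prev (next j))`, which must be identified with `u j`.
  N⇒closedNeighbours (u _) (inj₁ (fwd (uu j)))   = here (cong u (sym (prev-next j)))
  N⇒closedNeighbours (u i) (inj₁ (bwd (uu _)))   = there (there (here refl))
  N⇒closedNeighbours (u i) (inj₁ (bwd (uv _)))   = there (there (there (here refl)))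
  N⇒closedNeighbours (v i) (inj₂ refl)           = here refl
  N⇒closedNeighbours (v i) (inj₁ (fwd (uv _)))   = there (here refl)
  N⇒closedNeighbours (v i) (inj₁ (bwd (vw _)))   = there (there (here refl))
  N⇒closedNeighbours (v _) (inj₁ (bwd (v⁺w j)))  =
    there (there (there (here (cong w (sym (prev-next j))))))
  N⇒closedNeighbours (w i) (inj₂ refl)           = here refl
  N⇒closedNeighbours (w i) (inj₁ (bwd (wq _)))   = there (here refl)
  N⇒closedNeighbours (w i) (inj₁ (fwd (vw _)))   = there (there (here refl))
  N⇒closedNeighbours (w i) (inj₁ (fwd (v⁺w _)))  = there (there (there (here refl)))
  N⇒closedNeighbours (q i) (inj₂ refl)           = there (here refl)
  N⇒closedNeighbours (q _) (inj₁ (fwd (qq j)))   = here (cong q (sym (prev-next j)))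
  N⇒closedNeighbours (q i) (inj₁ (bwd (qq _)))   = there (there (here refl))
  N⇒closedNeighbours (q i) (inj₁ (fwd (wq _)))   = there (there (there (here refl)))

  closedNeighbours⇒N : ∀ x {y} → y ∈ closedNeighbours x → N[ x ] y
  -- The edge based at `prev i` ends at index `next (prev i)`, so it is transported to `i`.
  closedNeighbours⇒N (u i) (here refl) =
    inj₁ (fwd (subst (Edge (u (prev i)) ∘ u) (next-prev i) (uu (prev i))))
  closedNeighbours⇒N (u i) (there (here refl))                 = inj₂ refl
  closedNeighbours⇒N (u i) (there (there (here refl)))         = inj₁ (bwd (uu i))
  closedNeighbours⇒N (u i) (there (there (there (here refl)))) = inj₁ (bwd (uv i))
  closedNeighbours⇒N (v i) (here refl)                         = inj₂ refl
  closedNeighbours⇒N (v i) (there (here refl))                 = inj₁ (fwd (uv i))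
  closedNeighbours⇒N (v i) (there (there (here refl)))         = inj₁ (bwd (vw i))
  closedNeighbours⇒N (v i) (there (there (there (here refl)))) =
    inj₁ (bwd (subst (λ j → Edge (v j) (w (prev i))) (next-prev i) (v⁺w (prev i))))
  closedNeighbours⇒N (w i) (here refl)                         = inj₂ refl
  closedNeighbours⇒N (w i) (there (here refl))                 = inj₁ (bwd (wq i))
  closedNeighbours⇒N (w i) (there (there (here refl)))         = inj₁ (fwd (vw i))
  closedNeighbours⇒N (w i) (there (there (there (here refl)))) = inj₁ (fwd (v⁺w i))
  closedNeighbours⇒N (q i) (here refl) =
    inj₁ (fwd (subst (Edge (q (prev i)) ∘ q) (next-prev i) (qq (prev i))))
  closedNeighbours⇒N (q i) (there (here refl))                 = inj₂ refl
  closedNeighbours⇒N (q i) (there (there (here refl)))         = inj₁ (bwd (qq i))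
  closedNeighbours⇒N (q i) (there (there (there (here refl)))) = inj₁ (fwd (wq i))

  D-regular : IsRegular (D n n≥5) 3
  D-regular x =
      closedNeighbours x
    , closedNeighbours-unique x
    , closedNeighbours-length x
    , λ _ → mk⇔ (N⇒closedNeighbours x) (closedNeighbours⇒N x)

theorem2 : (n : ℕ) (n≥5 : n ≥ 5) → DBalanced (D n n≥5)
theorem2 n n≥5 = regular⇒DBalanced (D n n≥5) (D-regular n≥5)
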